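{- If $G$ is a finite simple undirected $(P_6,\text{bull})$-free graph that has an efficient dominating set, then its square $G^2$ is odd-antihole-free.
   Context: All graphs are finite, undirected and simple. A vertex dominates itself and its neighbors. A set $D\subseteq V$ is an efficient dominating set of $G=(V,E)$ if every vertex of $G$ is dominated by exactly one vertex of $D$. The square $G^2=(V,E^2)$ has $uv\in E^2$ iff $d_G(u,v)\in\{1,2\}$. $P_k$ is the chordless path on $k$ vertices; the bull is the 5-vertex graph consisting of a triangle together with two pendant (degree one) vertices attached to two different vertices of the triangle. $(P_6,\text{bull})$-free means having no induced subgraph isomorphic to $P_6$ or to the bull. Odd-antihole-free means having no induced subgraph isomorphic to the complement $\overline{C_{2k+1}}$ of a chordless cycle on $2k+1$ vertices, $k\ge 2$. -}

module Defs where

open import Data.Fin using (Fin; toℕ; #_)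
open import Data.Fin.Properties using (any?; all?; _≟_)
open import Data.Fin.Subset using (Subset; _∈_)
open import Data.List using (List; []; _∷_)
import Data.List.Membership.DecPropositional as DecMembership
open import Data.Nat using (ℕ; zero; suc; _+_; _*_; _≤_; _<_; z<s)
import Data.Nat as ℕ
open import Data.Nat.Properties using (1+n≢n; <-irrefl; allUpTo?)
open import Data.Product using (Σ-syntax; ∃!; _×_; _,_)
open import Data.Product.Properties using (≡-dec)
open import Data.Sum using (_⊎_; inj₁; inj₂; swap; map)
open import Function.Bundles using (_⇔_)
open import Function.Definitions using (Injective)
open import Level using (0ℓ)
open import Relation.Binary.Core using (Rel)
open import Relation.Binary.Definitions using (Decidable; Symmetric)
open import Relation.Binary.PropositionalEquality using (_≡_; _≢_; refl; sym)
open import Relation.Nullary using (¬_; Dec)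
open import Relation.Nullary.Decidable using (_×-dec_; _⊎-dec_; ¬?; from-yes; map′)

record Graph (n : ℕ) : Set₁ where
  field
    Adj        : Rel (Fin n) 0ℓ
    adj?       : Decidable Adj
    adj-sym    : Symmetric Adj
    adj-irrefl : ∀ v → ¬ Adj v v

open Graph public

module _ {n : ℕ} (R : Rel (Fin n) 0ℓ) (R? : Decidable R) (irr : ∀ v → ¬ R v v) where

  underlying : Graph n
  underlying .Adj u v = R u v ⊎ R v u
  underlying .adj? u v = R? u v ⊎-dec R? v u
  underlying .adj-sym = swap
  underlying .adj-irrefl v (inj₁ r) = irr v r
  underlying .adj-irrefl v (inj₂ r) = irr v r

path : ∀ n → Graph n
path n = underlying
  (λ i j → suc (toℕ i) ≡ toℕ j)
  (λ i j → suc (toℕ i) ℕ.≟ toℕ j)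
  (λ _ → 1+n≢n)

-- This is the chordless cycle Cₙ when n ≥ 3.  The condition 0 < j only matters
-- for n = 1, where it rules out a loop; it makes the definition total in n.
cycle : ∀ n → Graph n
cycle n = underlying R
  (λ i j → (suc (toℕ i) ℕ.≟ toℕ j) ⊎-dec
           ((toℕ i ℕ.≟ 0) ×-dec (0 ℕ.<? toℕ j) ×-dec (suc (toℕ j) ℕ.≟ n)))
  irr
  where
  R : Rel (Fin n) 0ℓ
  R i j = suc (toℕ i) ≡ toℕ j ⊎ (toℕ i ≡ 0 × 0 < toℕ j × suc (toℕ j) ≡ n)

  irr : ∀ v → ¬ R v v
  irr v (inj₁ e)              = 1+n≢n e
  irr v (inj₂ (e , 0<v , _)) = <-irrefl (sym e) 0<v

-- Triangle 0 1 2 with pendant vertices 3 and 4.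
bullEdges : List (Fin 5 × Fin 5)
bullEdges = (# 0 , # 1) ∷ (# 0 , # 2) ∷ (# 1 , # 2) ∷ (# 0 , # 3) ∷ (# 1 , # 4) ∷ []

open DecMembership (≡-dec (_≟_ {5}) (_≟_ {5})) using () renaming (_∈_ to _∈ₗ_; _∈?_ to _∈ₗ?_)

bull : Graph 5
bull = underlying
  (λ i j → (i , j) ∈ₗ bullEdges)
  (λ i j → (i , j) ∈ₗ? bullEdges)
  (from-yes (all? λ v → ¬? ((v , v) ∈ₗ? bullEdges)))

complement : ∀ {n} → Graph n → Graph n
complement G .Adj u v = u ≢ v × ¬ Adj G u v
complement G .adj? u v = ¬? (u ≟ v) ×-dec ¬? (adj? G u v)
complement G .adj-sym (u≢v , ¬uv) = (λ e → u≢v (sym e)) , (λ vu → ¬uv (adj-sym G vu))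
complement G .adj-irrefl v (v≢v , _) = v≢v refl

module _ {n : ℕ} (G : Graph n) where

  data Walk : Fin n → Fin n → ℕ → Set where
    []  : ∀ {u} → Walk u u 0
    _∷_ : ∀ {u w v l} → Adj G u w → Walk w v l → Walk u v (suc l)

  -- Relational: a pair in different components has no distance.
  Distance : Fin n → Fin n → ℕ → Set
  Distance u v d = Walk u v d × (∀ {l} → l < d → ¬ Walk u v l)

  walk? : ∀ u v l → Dec (Walk u v l)
  walk? u v zero    = map′ (λ { refl → [] }) (λ { [] → refl }) (u ≟ v)
  walk? u v (suc l) = map′ (λ { (_ , a , p) → a ∷ p }) (λ { (a ∷ p) → _ , a , p })
    (any? λ w → adj? G u w ×-dec walk? w v l)

  snoc : ∀ {u v w l} → Walk u v l → Adj G v w → Walk u w (suc l)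
  snoc []      a = a ∷ []
  snoc (b ∷ p) a = b ∷ snoc p a

  reverse : ∀ {u v l} → Walk u v l → Walk v u l
  reverse []      = []
  reverse (a ∷ p) = snoc (reverse p) (adj-sym G a)

  distance? : ∀ u v d → Dec (Distance u v d)
  distance? u v d = walk? u v d ×-dec allUpTo? (λ l → ¬? (walk? u v l)) d

  distance-sym : ∀ {u v d} → Distance u v d → Distance v u d
  distance-sym (p , min) = reverse p , λ l<d q → min l<d (reverse q)

  square : Graph n
  square .Adj u v = Distance u v 1 ⊎ Distance u v 2
  square .adj? u v = distance? u v 1 ⊎-dec distance? u v 2
  square .adj-sym = map distance-sym distance-sym
  square .adj-irrefl v (inj₁ (_ , min)) = min z<s []
  square .adj-irrefl v (inj₂ (_ , min)) = min z<s []

  Dominates : Fin n → Fin n → Set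
  Dominates d v = d ≡ v ⊎ Adj G d v

  EfficientDominating : Subset n → Set
  EfficientDominating D = ∀ v → ∃! _≡_ λ d → d ∈ D × Dominates d v

-- An isomorphism of H onto the subgraph of G induced by the image of f.
InducedSubgraph : ∀ {m n} → Graph m → Graph n → Set
InducedSubgraph {m} {n} H G = Σ[ f ∈ (Fin m → Fin n) ]
  (Injective _≡_ _≡_ f × (∀ i j → Adj H i j ⇔ Adj G (f i) (f j)))

infix 4 _-Free_

_-Free_ : ∀ {m n} → Graph m → Graph n → Set
H -Free G = ¬ InducedSubgraph H G

OddAntiholeFree : ∀ {n} → Graph n → Set
OddAntiholeFree G = ∀ k → 2 ≤ k → complement (cycle (2 * k + 1)) -Free G

{-# OPTIONS --safe #-}

-- Write u ≃ v for reflexive adjacency, i.e. Dominates, and δ v for the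
-- dominator of v.  Vertices with the same dominator are near (at distance at
-- most two), so on an antihole of G², read as a cyclic sequence v₀, v₁, … in
-- which exactly the consecutive vertices are far, δ is a proper colouring.
--
-- The graph-theoretic core concerns a far path x, y, z with δ x ≢ δ z, and a
-- far pair p, q such that y, p, x, z, q is a closed walk of near pairs.  If
-- neither δ p nor δ q is δ y, then a P₆ or a bull appears among these vertices,
-- the midpoints of the five near pairs, and the dominators of all ten, unless
-- δ p ≡ δ x and δ q ≡ δ z.
--
-- Hence in an antihole of length at least 7, if vᵢ and vᵢ₊₂ differ in colour,
-- then of any two consecutive vertices near all of vᵢ, vᵢ₊₁, vᵢ₊₂ one has the
-- colour of vᵢ₊₁.  If the length is odd, this forces vᵢ and vᵢ₊₂ to agree in
-- colour for all i, so that the colouring is constant and not proper.  In length 5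
-- the pairs x, q and z, p can also be made far, and then the exception in the core
-- disappears.
module Submission where

open import Defs
open import Algebra.Properties.CommutativeSemigroup using (x∙yz≈y∙xz; xy∙z≈xz∙y)
open import Data.Empty using (⊥)
open import Data.Fin using (Fin; toℕ)
open import Data.Fin.Properties using (_≟_; all?; sequence; toℕ-fromℕ<; toℕ-injective)
open import Data.List using (List; []; _∷_; map; mapMaybe; head)
open import Data.List.Relation.Unary.All using (All; []; _∷_)
open import Data.Maybe using (Maybe; just; nothing; _<∣>_; to-witness-T)
import Data.Maybe as Maybe
import Data.Maybe.Effectful as Maybe
open import Data.Nat using (ℕ; zero; suc; _+_; _*_; _∸_; _≤_; _<_; _≤?_; _<?_; s≤s; z<s; s<s; s≤s⁻¹; NonZero)
import Data.Nat as ℕ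
open import Data.Nat.DivMod using (_%_; _mod_; m%n<n; m<n⇒m%n≡m; n%n≡0; [m+n]%n≡m%n; %-distribˡ-+; m%n%n≡m%n; m≤n⇒[n∸m]%m≡n%m)
open import Data.Nat.Properties hiding (_≟_)
open import Data.Product using (∃; _×_; _,_; proj₁; proj₂)
open import Data.Sum using (_⊎_; inj₁; inj₂; fromInj₂)
import Data.Sum as Sum
open import Data.Vec using (Vec; []; _∷_; lookup)
open import Function using (_∘_; _$_; case_of_)
open import Function.Bundles using (mk⇔; module Equivalence)
open import Relation.Binary.Definitions using (DecidableEquality)
open import Relation.Binary.PropositionalEquality
  using (_≡_; _≢_; refl; sym; trans; cong; subst; module ≡-Reasoning)
open import Relation.Nullary using (¬_; Dec; yes; no; contradiction)
open import Relation.Nullary.Decidable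
  using (_×-dec_; _⊎-dec_; _→-dec_; ¬?; from-yes; map′; decidable-stable; True; toWitness)

-- Reflexive adjacency

module _ {n : ℕ} (G : Graph n) where

  dominates-sym : ∀ {u v} → Dominates G u v → Dominates G v u
  dominates-sym (inj₁ u≡v) = inj₁ (sym u≡v)
  dominates-sym (inj₂ uv)  = inj₂ (adj-sym G uv)

  dominates? : ∀ u v → Dec (Dominates G u v)
  dominates? u v = (u ≟ v) ⊎-dec adj? G u v

  -- The midpoint may coincide with an endpoint, so distances 0, 1 and 2 are treated alike.
  Near : Fin n → Fin n → Set
  Near u v = ∃ λ w → Dominates G u w × Dominates G w v

  Far : Fin n → Fin n → Set
  Far u v = ¬ Near u v

  near-sym : ∀ {u v} → Near u v → Near v u
  near-sym (w , uw , wv) = w , dominates-sym wv , dominates-sym uw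

  far-sym : ∀ {u v} → Far u v → Far v u
  far-sym far = far ∘ near-sym

  square⇒near : ∀ {u v} → Adj (square G) u v → Near u v
  square⇒near (inj₁ (uv ∷ [] , _))        = _ , inj₂ uv , inj₁ refl
  square⇒near (inj₂ (uw ∷ (wv ∷ []) , _)) = _ , inj₂ uw , inj₂ wv

  near⇒square : ∀ {u v} → u ≢ v → Near u v → Adj (square G) u v
  near⇒square {u} {v} u≢v near = case adj? G u v of λ where
      (yes uv) → inj₁ (uv ∷ [] , λ { z<s [] → u≢v refl })
      (no ¬uv) → inj₂ (walk ¬uv near , λ { z<s [] → u≢v refl ; (s<s z<s) (uv ∷ []) → ¬uv uv })
    where
    walk : ¬ Adj G u v → Near u v → Walk G u v 2
    walk ¬uv (_ , inj₁ refl , inj₁ refl) = contradiction refl u≢v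
    walk ¬uv (_ , inj₁ refl , inj₂ wv)   = contradiction wv ¬uv
    walk ¬uv (_ , inj₂ uw   , inj₁ refl) = contradiction uw ¬uv
    walk ¬uv (_ , inj₂ uw   , inj₂ wv)   = uw ∷ (wv ∷ [])

TwinFree : ∀ {m} → Graph m → Set
TwinFree H = ∀ i j → ¬ (Adj H i j ×
  (∀ k → Dominates H i k → Dominates H j k) × (∀ k → Dominates H j k → Dominates H i k))

twinFree? : ∀ {m} (H : Graph m) → Dec (TwinFree H)
twinFree? H = all? λ i → all? λ j → ¬? (adj? H i j
  ×-dec all? (λ k → dominates? H i k →-dec dominates? H j k)
  ×-dec all? (λ k → dominates? H j k →-dec dominates? H i k))

path₆-twinFree : TwinFree (path 6)
path₆-twinFree = from-yes (twinFree? (path 6))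

bull-twinFree : TwinFree bull
bull-twinFree = from-yes (twinFree? bull)

-- Injectivity of f need not be assumed: vertices of H with the same image
-- dominate the same vertices, so they would be true twins.
reflexive-free : ∀ {m n} {H : Graph m} {G : Graph n} → TwinFree H → H -Free G →
  (f : Fin m → Fin n) →
  (∀ i j → Dominates H i j → Dominates G (f i) (f j)) →
  (∀ i j → ¬ Dominates H i j → ¬ Dominates G (f i) (f j)) → ⊥
reflexive-free {H = H} {G} twinFree free f preserves reflects =
  free (f , injective , λ i j → mk⇔ (forth i j) (back i j))
  where
  reflect : ∀ i j → Dominates G (f i) (f j) → Dominates H i j
  reflect i j = decidable-stable (dominates? H i j) ∘ λ d ¬ij → reflects i j ¬ij d

  same : ∀ {i j} → f i ≡ f j → ∀ k → Dominates H i k → Dominates H j k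
  same {i} {j} e k d = reflect j k (subst (λ v → Dominates G v (f k)) e (preserves i k d))

  injective : ∀ {i j} → f i ≡ f j → i ≡ j
  injective {i} {j} e with reflect i j (inj₁ e)
  ... | inj₁ i≡j = i≡j
  ... | inj₂ ij  = contradiction (ij , same e , same (sym e)) (twinFree i j)

  forth : ∀ i j → Adj H i j → Adj G (f i) (f j)
  forth i j ij with preserves i j (inj₂ ij)
  ... | inj₁ e = contradiction (subst (Adj H i) (sym (injective e)) ij) (adj-irrefl H i)
  ... | inj₂ e = e

  back : ∀ i j → Adj G (f i) (f j) → Adj H i j
  back i j e with reflect i j (inj₂ e)
  ... | inj₁ refl = contradiction e (adj-irrefl G (f i))
  ... | inj₂ ij   = ij

-- Refutation by case distinction on adjacencies

-- Named vertices: pt i is an arbitrary vertex, dom i its dominator.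
data Point : Set where
  pt dom : ℕ → Point

data Kind : Set where
  adj non far : Kind

Fact : Set
Fact = Kind × Point × Point

-- In split i j r s, the refutation r treats i ≄ j and s treats i ≃ j.
data Refutation : Set where
  split           : (i j : Point) (r s : Refutation) → Refutation
  clash           : (i j : Point) → Refutation
  P₆              : (a b c d e f : Point) → Refutation
  bull⟨_,_,_,_,_⟩ : (a b c d e : Point) → Refutation

-- Argument order makes a refutation read as a proof: the first subrefutation excludes the opposite
-- case, and the relation named by the function is available in the second.
adjacent apart : Point → Point → Refutation → Refutation → Refutation
adjacent i j ¬ij ij = split i j ¬ij ij
apart    i j ij ¬ij = split i j ¬ij ij

_≟ᴾ_ : DecidableEquality Point
pt i  ≟ᴾ pt j  = map′ (cong pt) (λ { refl → refl }) (i ℕ.≟ j)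
dom i ≟ᴾ dom j = map′ (cong dom) (λ { refl → refl }) (i ℕ.≟ j)
pt _  ≟ᴾ dom _ = no λ ()
dom _ ≟ᴾ pt _  = no λ ()

_≟ᴷ_ : DecidableEquality Kind
adj ≟ᴷ adj = yes refl
non ≟ᴷ non = yes refl
far ≟ᴷ far = yes refl
adj ≟ᴷ non = no λ ()
adj ≟ᴷ far = no λ ()
non ≟ᴷ adj = no λ ()
non ≟ᴷ far = no λ ()
far ≟ᴷ adj = no λ ()
far ≟ᴷ non = no λ ()

first : ∀ {A B : Set} → (A → Maybe B) → List A → Maybe B
first f = head ∘ mapMaybe f

-- The core configuration

-- XZ is the midpoint of X and Z, and so on; X° is the dominator of X.
pattern X   = pt 0
pattern Y   = pt 1
pattern Z   = pt 2
pattern P   = pt 3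
pattern Q   = pt 4
pattern XZ  = pt 5
pattern YP  = pt 6
pattern YQ  = pt 7
pattern PX  = pt 8
pattern QZ  = pt 9
pattern X°  = dom 0
pattern Y°  = dom 1
pattern Z°  = dom 2
pattern P°  = dom 3
pattern Q°  = dom 4
pattern YQ° = dom 7

-- A difference of colours is recorded as non-adjacency to the other vertex's dominator.
pentagon : List Fact
pentagon =
  (far , X , Y) ∷ (far , Y , Z) ∷ (far , P , Q) ∷
  (adj , X , XZ) ∷ (adj , XZ , Z) ∷
  (adj , Y , YP) ∷ (adj , YP , P) ∷
  (adj , Y , YQ) ∷ (adj , YQ , Q) ∷
  (adj , P , PX) ∷ (adj , PX , X) ∷
  (adj , Q , QZ) ∷ (adj , QZ , Z) ∷
  (non , X , Y°) ∷ (non , X , Z°) ∷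
  (non , Y , X°) ∷ (non , Y , Z°) ∷
  (non , Z , X°) ∷ (non , Z , Y°) ∷
  (non , P , Y°) ∷ (non , Q , Y°) ∷ []

-- `untwisted` negates the conclusion that `P` has the colour of `X`. `twisted` is the exceptional
-- case, with both colour equalities recorded as domination and two more far pairs.
untwisted twisted : List Fact
untwisted = (non , P , X°) ∷ pentagon
twisted   = (adj , P , X°) ∷ (adj , Q , Z°) ∷ (far , X , Q) ∷ (far , Z , P) ∷ pentagon

-- Both refutations were found by computer search.
untwisted-refutation : Refutation
untwisted-refutation =
  apart YQ Y° (
    apart YP Y° (
      adjacent YP YQ (P₆ Q° Q YQ Y° YP P) $
      bull⟨ YP , YQ , Y° , P , Q ⟩) $
    adjacent Y Q (
      apart Y P (bull⟨ Y , YQ , Y° , P , Q ⟩) $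
      adjacent YP YQ (bull⟨ Y , YQ , Y° , YP , Q ⟩) $
      bull⟨ YQ , YP , Y , Q , P ⟩) $
    adjacent X P (
      adjacent YP PX (P₆ X PX P YP Y Q) $
      bull⟨ PX , YP , P , X , Y ⟩) $
    apart Q X° (P₆ P X X° Q Y Y°) $
    adjacent YP X° (P₆ X° X P YP Y Q) $
    P₆ Q° Q Y YP X° X) $
  apart YP X° (
    apart Y P (bull⟨ YP , Y , P , X° , Y° ⟩) $
    apart YP YQ (bull⟨ Y , YP , YQ , Y° , P ⟩) $
    adjacent YQ X° (P₆ YQ° YQ Y YP X° X) $
    apart X P (P₆ Y° Y YQ X° X P) $
    apart YP PX (bull⟨ PX , YP , P , X , Y ⟩) $
    adjacent YQ PX (P₆ X PX P YP Y YQ) $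
    adjacent PX Y° (P₆ X PX P YP Y Y°) $
    apart PX X° (bull⟨ PX , X° , X , Y° , YP ⟩) $
    apart Y Q (bull⟨ Y , YQ , Q , YP , PX ⟩) $
    apart Z PX (P₆ X° YP Y Y° PX Z) $
    apart Z P (P₆ Z P YP Y YQ Q) $
    apart Z Q (P₆ Z Q YQ PX P YP) $
    apart YQ QZ (bull⟨ QZ , YQ , Q , Z , Y ⟩) $
    adjacent YP QZ (P₆ QZ Q YQ Y YP P) $
    adjacent PX QZ (P₆ YQ PX P YP QZ Z) $
    adjacent QZ Y° (P₆ Z QZ Q YQ Y Y°) $
    bull⟨ QZ , PX , Y° , Z , YQ ⟩) $
  apart X P (
    apart YQ X° (P₆ P X X° YQ Y Y°) $
    adjacent YP YQ (P₆ X° X P YP Y YQ) $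
    adjacent YP Y° (P₆ X° X P YP Y Y°) $
    adjacent Q X° (P₆ X° X P YP YQ Q) $
    P₆ Q X° X P YP Y°) $
  adjacent Y P (
    apart YP PX (bull⟨ YP , PX , P , Y , X ⟩) $
    adjacent PX X° (P₆ Y YP P PX X X°) $
    adjacent YP Y° (P₆ X° PX P YP Y Y°) $
    apart Q X° (P₆ Q X° PX P YP Y°) $
    apart X Q (bull⟨ PX , X , X° , P , Q ⟩) $
    apart Y Q (P₆ X PX P YP Y Q) $
    apart YP YQ (bull⟨ YQ , YP , Y , Q , P ⟩) $
    adjacent YQ PX (P₆ YQ Y YP P PX X) $
    P₆ Y° YP P PX YQ Q) $
  apart QZ Y° (
    adjacent P Z° (P₆ Z° Z QZ Y° Y P) $
    P₆ Z° P Y Y° QZ Q) $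
  apart P Z° (
    adjacent QZ Z° (P₆ Y° Y P Z° Z QZ) $
    P₆ Y° Y P Z° QZ Q) $
  apart QZ P° (P₆ Y° Y P P° QZ Z) $
  adjacent YQ P° (
    adjacent YQ QZ (P₆ P° P Y YQ Q QZ) $
    P₆ P° P Y YQ QZ Z) $
  adjacent Z Q (
    adjacent YQ QZ (P₆ Z QZ Q YQ Y P) $
    bull⟨ QZ , YQ , Q , Z , Y ⟩) $
  adjacent Q Z° (P₆ Z° Z Q YQ Y P) $
  apart X Q (P₆ X° X Q YQ Y P) $
  apart X Z (P₆ X° X Z Q YQ Y) $
  adjacent YQ PX (P₆ X PX P Y YQ Q) $
  apart PX Y° (P₆ Z° Q YQ PX X X°) $
  adjacent PX X° (P₆ Y° Y P PX X X°) $
  apart Z PX (P₆ Y° Y P PX Z Q) $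
  adjacent P XZ (
    adjacent XZ PX (P₆ Y P PX X XZ Z) $
    bull⟨ XZ , PX , X , Z , P ⟩) $
  adjacent XZ Y° (P₆ Y° Y P XZ Z Q) $
  apart XZ PX (bull⟨ P , XZ , PX , Y , Z ⟩) $
  adjacent XZ X° (P₆ X° PX P XZ Z Q) $
  clash XZ Y°

twisted-refutation : Refutation
twisted-refutation =
  apart X Z (P₆ P X° X Z Z° Q) $
  adjacent Z Q (
    apart XZ Z° bull⟨ Z° , XZ , Z , Q , X ⟩ $
    adjacent XZ X° (P₆ Q Z° Z XZ X X°) $
    P₆ Q Z° Z XZ X° P) $
  adjacent X P (
    adjacent XZ PX (P₆ P PX X XZ Z Q) $
    bull⟨ PX , XZ , X , P , Z ⟩) $
  adjacent YP YQ (P₆ X P YP Y YQ Q) $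
  P₆ X P YP YQ Q Z

-- Soundness of refutations

module Refuting {n : ℕ} (G : Graph n)
  (P₆-free : path 6 -Free G) (bull-free : bull -Free G)
  (δ : Fin n → Fin n) (dominated : ∀ v → Dominates G (δ v) v)
  (unique : ∀ {u v} → Dominates G (δ u) v → δ v ≡ δ u) where

  ⟦_⟧ᴾ : Point → (ℕ → Fin n) → Fin n
  ⟦ pt i ⟧ᴾ ρ  = ρ i
  ⟦ dom i ⟧ᴾ ρ = δ (ρ i)

  ⟦_⟧ᴷ : Kind → Fin n → Fin n → Set
  ⟦ adj ⟧ᴷ u v = Dominates G u v
  ⟦ non ⟧ᴷ u v = ¬ Dominates G u v
  ⟦ far ⟧ᴷ u v = Far G u v

  ⟦_⟧ : Fact → (ℕ → Fin n) → Set
  ⟦ κ , i , j ⟧ ρ = ⟦ κ ⟧ᴷ (⟦ i ⟧ᴾ ρ) (⟦ j ⟧ᴾ ρ)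

  _Satisfies_ : (ℕ → Fin n) → List Fact → Set
  ρ Satisfies Γ = All (λ φ → ⟦ φ ⟧ ρ) Γ

  record _⊨_ (Γ : List Fact) (φ : Fact) : Set where
    constructor entails
    field holds : ∀ ρ → ρ Satisfies Γ → ⟦ φ ⟧ ρ

  open _⊨_

  Inconsistent : List Fact → Set
  Inconsistent Γ = ∀ ρ → ¬ ρ Satisfies Γ

  Related : List Fact → Kind → Point → Set
  Related Γ κ i = ∃ λ j → Γ ⊨ (κ , i , j)

  symmetric : ∀ κ {u v} → ⟦ κ ⟧ᴷ u v → ⟦ κ ⟧ᴷ v u
  symmetric adj = dominates-sym G
  symmetric non = _∘ dominates-sym G
  symmetric far = far-sym G

  converse : ∀ {Γ κ i j} → Γ ⊨ (κ , i , j) → Γ ⊨ (κ , j , i)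
  converse {κ = κ} e = entails λ ρ h → symmetric κ (holds e ρ h)

  weaken : ∀ {Γ φ κ i} → Related Γ κ i → Related (φ ∷ Γ) κ i
  weaken (j , e) = j , entails λ { ρ (_ ∷ h) → holds e ρ h }

  stated : ∀ Γ κ i → List (Related Γ κ i)
  stated [] κ i = []
  stated ((κ′ , j , k) ∷ Γ) κ i with κ′ ≟ᴷ κ | j ≟ᴾ i | k ≟ᴾ i
  ... | yes refl | yes refl | _        = (k , entails λ { ρ (h ∷ _) → h }) ∷ map weaken (stated Γ κ i)
  ... | yes refl | no _     | yes refl = (j , entails λ { ρ (h ∷ _) → symmetric κ h }) ∷ map weaken (stated Γ κ i)
  ... | _        | _        | _        = map weaken (stated Γ κ i)

  neighbours : ∀ Γ i → List (Related Γ adj i)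
  neighbours Γ i = (i , entails λ _ _ → inj₁ refl) ∷ partner i ∷ stated Γ adj i
    where
    partner : ∀ i → Related Γ adj i
    partner (pt i)  = dom i , entails λ ρ _ → dominates-sym G (dominated (ρ i))
    partner (dom i) = pt i , entails λ ρ _ → dominated (ρ i)

  at : ∀ {Γ κ i} j → Related Γ κ i → Maybe (Γ ⊨ (κ , i , j))
  at j (k , e) with k ≟ᴾ j
  ... | yes refl = just e
  ... | no _     = nothing

  -- A midpoint would be dominated by both dominators, which would then coincide; `w` tells them
  -- apart.
  distinct-dominators-far : ∀ {u v w} → Dominates G (δ u) w → ¬ Dominates G w (δ v) → Far G (δ u) (δ v)
  distinct-dominators-far {w = w} uw w≄v (z , uz , zv) =
    w≄v (dominates-sym G (subst (λ d → Dominates G d w) δu≡δv uw))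
    where
    δu≡δv = trans (sym (unique uz)) (unique (dominates-sym G zv))

  separated? : ∀ Γ i j → Maybe (Γ ⊨ (far , i , j))
  separated? Γ (dom i) (dom j) = first
    (λ (k , ik) → Maybe.map
      (λ k≄j → entails λ ρ h → distinct-dominators-far (holds ik ρ h) (holds k≄j ρ h))
      (first (at (dom j)) (stated Γ non k)))
    (neighbours Γ (dom i))
  separated? _ _ _ = nothing

  far? : ∀ Γ i j → Maybe (Γ ⊨ (far , i , j))
  far? Γ i j = first (at j) (stated Γ far i)
    <∣> separated? Γ i j <∣> Maybe.map converse (separated? Γ j i)

  -- If `i` is far from a `k` with `j ≃ k`, then `i ≃ j` would make `j` a midpoint of `i` and `k`.
  -- The choice `k = j` turns far pairs into non-adjacent ones.
  far-from-neighbour? : ∀ Γ i j → Maybe (Γ ⊨ (non , i , j))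
  far-from-neighbour? Γ i j = first
    (λ (k , jk) → Maybe.map
      (λ ik → entails λ ρ h ij → holds ik ρ h (_ , ij , holds jk ρ h))
      (far? Γ i k))
    (neighbours Γ j)

  derive : ∀ Γ φ → Maybe (Γ ⊨ φ)
  derive Γ (adj , i , j) = first (at j) (neighbours Γ i)
  derive Γ (non , i , j) = first (at j) (stated Γ non i)
    <∣> far-from-neighbour? Γ i j <∣> Maybe.map converse (far-from-neighbour? Γ j i)
  derive Γ (far , i , j) = far? Γ i j

  kind : {A : Set} → Dec A → Kind
  kind (yes _) = adj
  kind (no _)  = non

  kind-adj : ∀ {A u v} (a? : Dec A) → ⟦ kind a? ⟧ᴷ u v → A → Dominates G u v
  kind-adj (yes _) uv _ = uv
  kind-adj (no ¬a) _  a = contradiction a ¬a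

  kind-non : ∀ {A u v} (a? : Dec A) → ⟦ kind a? ⟧ᴷ u v → ¬ A → ¬ Dominates G u v
  kind-non (yes a) _  ¬a = contradiction a ¬a
  kind-non (no _)  uv _  = uv

  induced? : ∀ {m} (H : Graph m) → TwinFree H → H -Free G → ∀ Γ → Vec Point m → Maybe (Inconsistent Γ)
  induced? H twinFree free Γ f = Maybe.map
    (λ e ρ h → reflexive-free {H = H} {G} twinFree free (λ i → ⟦ lookup f i ⟧ᴾ ρ)
      (λ i j → kind-adj (dominates? H i j) (holds (e i j) ρ h))
      (λ i j → kind-non (dominates? H i j) (holds (e i j) ρ h)))
    (sequence Maybe.applicative λ i → sequence Maybe.applicative λ j →
      derive Γ (kind (dominates? H i j) , lookup f i , lookup f j))

  refute : Refutation → ∀ Γ → Maybe (Inconsistent Γ)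
  refute (split i j r s) Γ = Maybe.zipWith
    (λ ¬ij-case ij-case ρ h → case dominates? G (⟦ i ⟧ᴾ ρ) (⟦ j ⟧ᴾ ρ) of λ where
      (yes ij) → ij-case ρ (ij ∷ h)
      (no ¬ij) → ¬ij-case ρ (¬ij ∷ h))
    (refute r ((non , i , j) ∷ Γ)) (refute s ((adj , i , j) ∷ Γ))
  refute (clash i j) Γ = Maybe.zipWith (λ ij ¬ij ρ h → holds ¬ij ρ h (holds ij ρ h))
    (derive Γ (adj , i , j)) (derive Γ (non , i , j))
  refute (P₆ a b c d e f) Γ =
    induced? (path 6) path₆-twinFree P₆-free Γ (a ∷ b ∷ c ∷ d ∷ e ∷ f ∷ [])
  refute bull⟨ a , b , c , d , e ⟩ Γ =
    induced? bull bull-twinFree bull-free Γ (a ∷ b ∷ c ∷ d ∷ e ∷ [])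

  abstract
    untwisted-inconsistent : Inconsistent untwisted
    -- Whether `refute` succeeds depends only on the refutation and the facts, not on `G` or `δ`, so
    -- success is decided by evaluation.
    untwisted-inconsistent = to-witness-T (refute untwisted-refutation untwisted) _

    twisted-inconsistent : Inconsistent twisted
    twisted-inconsistent = to-witness-T (refute twisted-refutation twisted) _

  undominated : ∀ {u v} → δ u ≢ δ v → ¬ Dominates G u (δ v)
  undominated u≢v = u≢v ∘ unique ∘ dominates-sym G

  far⇒distinct : ∀ {u v} → Far G u v → δ u ≢ δ v
  far⇒distinct {u} {v} u-v δu≡δv = u-v (δ u , dominates-sym G (dominated u) ,
    subst (λ d → Dominates G d v) (sym δu≡δv) (dominated v))

  module _ {x y z p q}
    (x-y : Far G x y) (y-z : Far G y z) (p-q : Far G p q)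
    (x~z : Near G x z) (y~p : Near G y p) (y~q : Near G y q) (p~x : Near G p x) (q~z : Near G q z)
    (x≢z : δ x ≢ δ z) (p≢y : δ p ≢ δ y) (q≢y : δ q ≢ δ y) where

    points : ℕ → Fin n
    points 0 = x
    points 1 = y
    points 2 = z
    points 3 = p
    points 4 = q
    points 5 = proj₁ x~z
    points 6 = proj₁ y~p
    points 7 = proj₁ y~q
    points 8 = proj₁ p~x
    -- Index 9, the last one in use, doubles as the default.
    points _ = proj₁ q~z

    points-pentagon : points Satisfies pentagon
    points-pentagon =
      x-y ∷ y-z ∷ p-q ∷
      proj₁ (proj₂ x~z) ∷ proj₂ (proj₂ x~z) ∷
      proj₁ (proj₂ y~p) ∷ proj₂ (proj₂ y~p) ∷
      proj₁ (proj₂ y~q) ∷ proj₂ (proj₂ y~q) ∷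
      proj₁ (proj₂ p~x) ∷ proj₂ (proj₂ p~x) ∷
      proj₁ (proj₂ q~z) ∷ proj₂ (proj₂ q~z) ∷
      undominated x≢y ∷ undominated x≢z ∷
      undominated (x≢y ∘ sym) ∷ undominated y≢z ∷
      undominated (x≢z ∘ sym) ∷ undominated (y≢z ∘ sym) ∷
      undominated p≢y ∷ undominated q≢y ∷ []
      where
      x≢y = far⇒distinct x-y
      y≢z = far⇒distinct y-z

    -- The hypotheses are invariant under exchanging `x` with `z` and `p` with `q`, so this also
    -- yields `δ q ≡ δ z`.
    core : δ p ≡ δ x
    core = decidable-stable (δ p ≟ δ x) λ p≢x →
      untwisted-inconsistent points (undominated p≢x ∷ points-pentagon)

    core-twisted : δ q ≡ δ z → Far G x q → ¬ Far G z p
    core-twisted q≡z x-q z-p = twisted-inconsistent points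
      (same core ∷ same q≡z ∷ x-q ∷ z-p ∷ points-pentagon)
      where
      same : ∀ {u v} → δ u ≡ δ v → Dominates G u (δ v)
      same {u} e = subst (Dominates G u) e (dominates-sym G (dominated u))

-- Colourings of an odd cycle

module CyclicColouring {A : Set} (_≟_ : DecidableEquality A) (N : ℕ) (c : ℕ → A)
  (periodic : ∀ i → c (N + i) ≡ c i) (proper : ∀ i → c i ≢ c (1 + i)) where

  -- As the colouring is proper, the three vertices from `i` on then have pairwise distinct colours.
  Rainbow : ℕ → Set
  Rainbow i = c i ≢ c (2 + i)

  -- Without rainbows all even indices up to `k * 2` share a colour, but `k * 2` is the cyclic
  -- predecessor of 0.
  odd⇒rainbow : ∀ {k} → N ≡ 1 + k * 2 → ¬ (∀ i → ¬ Rainbow i)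
  odd⇒rainbow {k} odd none = proper (k * 2) (trans (sym (constant k))
    (trans (sym (periodic 0)) (cong c (trans (+-identityʳ N) odd))))
    where
    constant : ∀ j → c 0 ≡ c (j * 2)
    constant zero    = refl
    constant (suc j) = trans (constant j) (decidable-stable (_ ≟ _) (none (j * 2)))

  -- Two of the five equations c i ≡ c (2 + i) that are two steps apart cannot
  -- both hold, so three consecutive ones fail.
  pentagon-rainbows : N ≡ 5 → ¬ (∀ i → Rainbow i → Rainbow (1 + i) → ¬ Rainbow (2 + i))
  pentagon-rainbows refl none = case c 0 ≟ c 2 of λ where
      (yes e₀) → case c 1 ≟ c 3 of λ where
        (yes e₁) → none 2 (up 0 e₀) (up 1 e₁) (down 4 (round 1 e₁))
        (no ¬e₁) → none 1 ¬e₁ (up 0 e₀) (down 3 (round 0 e₀))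
      (no ¬e₀) → case c 1 ≟ c 3 of λ where
        (yes e₁) → none 3 (up 1 e₁) (down 4 (round 1 e₁)) (¬e₀ ∘ unround 0)
        (no ¬e₁) → case c 2 ≟ c 4 of λ where
          (yes e₂) → none 4 (up 2 e₂) (¬e₀ ∘ unround 0) (¬e₁ ∘ unround 1)
          (no ¬e₂) → none 0 ¬e₀ ¬e₁ ¬e₂
    where
    round : ∀ i → c i ≡ c (2 + i) → c (5 + i) ≡ c (7 + i)
    round i e = trans (periodic i) (trans e (sym (periodic (2 + i))))

    unround : ∀ i → c (5 + i) ≡ c (7 + i) → c i ≡ c (2 + i)
    unround i e = trans (sym (periodic i)) (trans e (periodic (2 + i)))

    -- Chaining the two equations gives `4 + i` the colour of `i`, hence of its successor `5 + i`.
    up : ∀ i → c i ≡ c (2 + i) → Rainbow (2 + i)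
    up i e e′ = proper (4 + i) (sym (trans (periodic i) (trans e e′)))

    down : ∀ i → c (2 + i) ≡ c (4 + i) → Rainbow i
    down i e e′ = proper (4 + i) (sym (trans (periodic i) (trans e′ e)))

  -- The bounds keep `e + i` and `1 + e + i` at cyclic distance at least two from `i`, `1 + i` and
  -- `2 + i`.
  module _ (edge : ∀ i e → Rainbow i → 4 ≤ e → 3 + e ≤ N →
                   c (e + i) ≡ c (1 + i) ⊎ c (1 + e + i) ≡ c (1 + i)) where

    next : ∀ i e → Rainbow i → 4 ≤ e → 3 + e ≤ N →
      c (e + i) ≢ c (1 + i) → c (1 + e + i) ≡ c (1 + i)
    next i e r 4≤e e≤N ≢ = fromInj₂ (λ eq → contradiction eq ≢) (edge i e r 4≤e e≤N)

    -- Otherwise `6 + i` also gets the colour of `1 + i`, the triples from `1 + i` and `2 + i` are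
    -- rainbow, and `7 + i` is forced to the colours of both `2 + i` and `3 + i`.
    rainbow-centre : 8 ≤ N → ∀ i → Rainbow i → c (4 + i) ≢ c (1 + i)
    rainbow-centre 8≤N i r c₄≡c₁ = proper (2 + i) (trans (sym c₇≡c₂) c₇≡c₃)
      where
      7≤N = ≤-trans (n≤1+n 7) 8≤N
      c₆≡c₁ = next i 5 r (m≤m+n 4 1) 8≤N (λ e → proper (4 + i) (trans c₄≡c₁ (sym e)))
      c₇≡c₂ = next (1 + i) 5 (λ e → proper (3 + i) (trans (sym e) (sym c₄≡c₁))) (m≤m+n 4 1) 8≤N
        (λ e → proper (1 + i) (trans (sym c₆≡c₁) e))
      c₇≡c₃ = next (2 + i) 4 (λ e → proper (1 + i) (sym (trans e c₄≡c₁))) ≤-refl 7≤N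
        (λ e → proper (3 + i) (trans (sym e) (trans c₆≡c₁ (sym c₄≡c₁))))

    module _ (N≡7 : N ≡ 7) where

      7≤N : 7 ≤ N
      7≤N = ≤-reflexive (sym N≡7)

      wrap : ∀ i → c (7 + i) ≡ c i
      wrap i = subst (λ N → c (N + i) ≡ c i) N≡7 (periodic i)

      -- In length 7 `edge` allows only `e = 4`, so the contradiction comes from going around the
      -- cycle.
      rainbow-centre₇ : ∀ i → Rainbow i → c (4 + i) ≢ c (1 + i)
      rainbow-centre₇ i r c₄≡c₁
        with edge (1 + i) 4 (λ e → proper (3 + i) (trans (sym e) (sym c₄≡c₁))) ≤-refl 7≤N
      -- Modulo 7, the triples from `5 + i` and `6 + i` give `3 + i` the colour of `6 + i` and
      -- `4 + i` that of `i`; so `i` and `1 + i` agree.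
      ... | inj₁ c₅≡c₂ = proper i
          (trans (sym (wrap i)) (trans (sym c₁₁≡c₇) (trans (wrap (4 + i)) c₄≡c₁)))
        where
        c₁₀≡c₆ = next (5 + i) 4 (λ e → r (trans (sym (wrap i)) (trans (sym e) c₅≡c₂))) ≤-refl 7≤N
          (λ e → proper (5 + i) (trans c₅≡c₂ (trans (sym (wrap (2 + i))) e)))
        c₁₁≡c₇ = next (6 + i) 4
          (λ e → proper (3 + i) (trans (sym (wrap (3 + i)))
            (trans c₁₀≡c₆ (trans e (trans (wrap (1 + i)) (sym c₄≡c₁))))))
          ≤-refl 7≤N (λ e → proper (6 + i) (trans (sym c₁₀≡c₆) e))
      -- The triple from `4 + i` gives `2 + i` the colour of `5 + i`, so `5 + i` and `6 + i` agree.
      ... | inj₂ c₆≡c₂ = proper (5 + i) (trans (sym c₉≡c₅) (trans (wrap (2 + i)) (sym c₆≡c₂)))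
        where
        c₉≡c₅ = next (4 + i) 4 (λ e → proper (1 + i) (trans (sym c₄≡c₁) (trans e c₆≡c₂))) ≤-refl 7≤N
          (λ e → proper (4 + i) (trans c₄≡c₁ (trans (sym (wrap (1 + i))) e)))

      -- A rainbow at `i` forces one at `5 + i` and then one at `1 + i`; these give `6 + i` the
      -- colours of both `3 + i` and `2 + i`.
      no-rainbow₇ : ∀ i → ¬ Rainbow i
      no-rainbow₇ i r = proper (2 + i) (trans (sym c₆≡c₂) (trans (sym c₁₀≡c₆) (wrap (3 + i))))
        where
        c₅≡c₁ = next i 4 r ≤-refl 7≤N (rainbow-centre₇ i r)
        r₅ : Rainbow (5 + i)
        r₅ e = proper i (trans (sym (wrap i)) (trans (sym e) c₅≡c₁))
        c₁₀≡c₆ = next (5 + i) 4 r₅ ≤-refl 7≤N (rainbow-centre₇ (5 + i) r₅)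
        c₆≡c₂ = next (1 + i) 4
          (λ e → proper (5 + i) (trans c₅≡c₁ (trans e (trans (sym (wrap (3 + i))) c₁₀≡c₆))))
          ≤-refl 7≤N (λ e → proper (1 + i) (trans (sym c₅≡c₁) e))

    module _ {m} (N≡9+2m : N ≡ 9 + m * 2) where

      9≤N : 9 ≤ N
      9≤N = subst (9 ≤_) (sym N≡9+2m) (m≤m+n 9 (m * 2))

      7≤N′ : 7 ≤ N
      7≤N′ = ≤-trans (m≤m+n 7 2) 9≤N

      centre : ∀ i → Rainbow i → c (4 + i) ≢ c (1 + i)
      centre = rainbow-centre (≤-trans (n≤1+n 8) 9≤N)

      -- Once a vertex has the colour of `1 + i`, its successor has not, so `edge` hands the colour
      -- to the vertex after that. At `j = 1 + m` this reaches `i - 2` modulo `N`, the end of the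
      -- range of `edge`.
      alternate : ∀ i → Rainbow i → ∀ j → j ≤ 1 + m → c (5 + j * 2 + i) ≡ c (1 + i)
      alternate i r zero    _         = next i 4 r ≤-refl 7≤N′ (centre i r)
      alternate i r (suc j) (s≤s j≤m) = next i (6 + j * 2) r (m≤m+n 4 (2 + j * 2))
        (subst (9 + j * 2 ≤_) (sym N≡9+2m) (+-monoʳ-≤ 9 (*-monoˡ-≤ 2 j≤m)))
        (λ e → proper (5 + j * 2 + i) (trans (alternate i r j (m≤n⇒m≤1+n j≤m)) (sym e)))

      -- By alternation t = i - 2 (mod N) has the colour of 1 + i, which
      -- makes both t and 2 + t rainbow.
      no-rainbow₉ : ∀ i → ¬ Rainbow i
      no-rainbow₉ i r = proper t
        (trans cₜ≡c₁ (trans (sym (around 1)) (trans (sym c₇₊ₜ≡c₃₊ₜ) c₇₊ₜ≡c₁₊ₜ)))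
        where
        t = 7 + m * 2 + i
        around : ∀ k → c (k + (2 + t)) ≡ c (k + i)
        around k = trans (cong (λ l → c (k + (l + i))) (sym N≡9+2m))
          (trans (cong c (x∙yz≈y∙xz +-commutativeSemigroup k N i)) (periodic (k + i)))
        cₜ≡c₁ = alternate i r (1 + m) ≤-refl
        rₜ : Rainbow t
        rₜ e = proper i (trans (sym (around 0)) (trans (sym e) cₜ≡c₁))
        r₂₊ₜ : Rainbow (2 + t)
        r₂₊ₜ e = r (trans (sym (around 0)) (trans e (around 2)))
        -- The rainbow at `t` gives `7 + t` the colour of `1 + t`; the one at `2 + t` gives it that
        -- of `3 + t`, which is the colour of `1 + i` and so of `t`.
        c₅₊ₜ≡c₁₊ₜ = next t 4 rₜ ≤-refl 7≤N′ (centre t rₜ)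
        c₇₊ₜ≡c₁₊ₜ = next t 6 rₜ (m≤m+n 4 2) 9≤N (λ e → proper (5 + t) (trans c₅₊ₜ≡c₁₊ₜ (sym e)))
        c₇₊ₜ≡c₃₊ₜ = next (2 + t) 4 r₂₊ₜ ≤-refl 7≤N′ (centre (2 + t) r₂₊ₜ)

-- Antiholes as periodic sequences

module _ (N : ℕ) .{{_ : NonZero N}} where

  toℕ-mod : ∀ i → toℕ (i mod N) ≡ i % N
  toℕ-mod i = toℕ-fromℕ< (m%n<n i N)

  mod-periodic : ∀ i → (N + i) mod N ≡ i mod N
  mod-periodic i = toℕ-injective (trans (toℕ-mod (N + i))
    (trans (trans (cong (_% N) (+-comm N i)) ([m+n]%n≡m%n i N)) (sym (toℕ-mod i))))

  %-shift : ∀ d i → (d + i) % N ≡ (d + i % N) % N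
  %-shift d i = begin
    (d + i) % N             ≡⟨ %-distribˡ-+ d i N ⟩
    (d % N + i % N) % N     ≡⟨ cong (λ r → (d % N + r) % N) (m%n%n≡m%n i N) ⟨
    (d % N + i % N % N) % N ≡⟨ %-distribˡ-+ d (i % N) N ⟨
    (d + i % N) % N         ∎
    where open ≡-Reasoning

  %-shift-distinct : ∀ {d i} → 0 < d → d < N → i % N ≢ (d + i) % N
  %-shift-distinct {d} {i} 0<d d<N e with d + i % N <? N
  ... | yes small = <⇒≢ (m<n+m (i % N) 0<d) (trans e (trans (%-shift d i) (m<n⇒m%n≡m small)))
  -- The sum wraps around once and, as `d < N`, lands below `i % N`.
  ... | no  large = <⇒≢ lower (sym (trans e (trans (%-shift d i)
      (trans (sym (m≤n⇒[n∸m]%m≡n%m N≤)) (m<n⇒m%n≡m (<-trans lower (m%n<n i N)))))))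
    where
    N≤ : N ≤ d + i % N
    N≤ = ≮⇒≥ large
    lower : d + i % N ∸ N < i % N
    lower = +-cancelʳ-< N _ _ (begin-strict
      d + i % N ∸ N + N ≡⟨ m∸n+n≡m N≤ ⟩
      d + i % N         <⟨ +-monoˡ-< (i % N) d<N ⟩
      N + i % N         ≡⟨ +-comm N (i % N) ⟩
      i % N + N         ∎)
      where open ≤-Reasoning

  %-distinct : ∀ {i j} → i < j → j < i + N → i % N ≢ j % N
  %-distinct {i} {j} i<j j<i+N e = %-shift-distinct (m<n⇒0<n∸m i<j)
    (+-cancelˡ-< i _ _ (subst (_< i + N) (sym (m+[n∸m]≡n (<⇒≤ i<j))) j<i+N))
    (trans e (cong (_% N) (sym (m∸n+n≡m (<⇒≤ i<j)))))

  cycle-mod-suc : 2 ≤ N → ∀ i → Adj (cycle N) (i mod N) ((1 + i) mod N)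
  cycle-mod-suc 2≤N i with 1 + i % N <? N
  ... | yes small = inj₁ (inj₁ (trans (cong suc (toℕ-mod i))
          (sym (trans (toℕ-mod (1 + i)) (trans (%-shift 1 i) (m<n⇒m%n≡m small))))))
  ... | no large = inj₂ (inj₂
          ( trans (toℕ-mod (1 + i)) (trans (%-shift 1 i) (trans (cong (_% N) last) (n%n≡0 N)))
          , subst (0 <_) (sym (toℕ-mod i)) (s≤s⁻¹ (subst (2 ≤_) (sym last) 2≤N))
          , trans (cong suc (toℕ-mod i)) last))
    where
    last : 1 + i % N ≡ N
    last = ≤-antisym (m%n<n i N) (≮⇒≥ large)

  cycle⇒consecutive : ∀ {a b} → Adj (cycle N) a b →
    suc (toℕ a) % N ≡ toℕ b % N ⊎ suc (toℕ b) % N ≡ toℕ a % N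
  cycle⇒consecutive = λ where
      (inj₁ (inj₁ e))                 → inj₁ (cong (_% N) e)
      (inj₁ (inj₂ (a≡0 , _ , b≡N-1))) → inj₂ (closing a≡0 b≡N-1)
      (inj₂ (inj₁ e))                 → inj₂ (cong (_% N) e)
      (inj₂ (inj₂ (b≡0 , _ , a≡N-1))) → inj₁ (closing b≡0 a≡N-1)
    where
    closing : ∀ {a b} → a ≡ 0 → suc b ≡ N → suc b % N ≡ a % N
    closing refl refl = [m+n]%n≡m%n 0 N

  cycle-mod⇒consecutive : ∀ {i j} → Adj (cycle N) (i mod N) (j mod N) →
    (1 + i) % N ≡ j % N ⊎ (1 + j) % N ≡ i % N
  cycle-mod⇒consecutive {i} {j} = Sum.map (reduce i j) (reduce j i) ∘ cycle⇒consecutive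
    where
    reduce : ∀ i j → suc (toℕ (i mod N)) % N ≡ toℕ (j mod N) % N → suc i % N ≡ j % N
    reduce i j e = trans (%-shift 1 i) (trans (cong (λ a → suc a % N) (sym (toℕ-mod i)))
      (trans e (trans (cong (_% N) (toℕ-mod j)) (m%n%n≡m%n j N))))

  mod-nonadjacent : ∀ {i j} → 2 + i ≤ j → 2 + j ≤ i + N → ¬ Adj (cycle N) (i mod N) (j mod N)
  mod-nonadjacent {i} {j} i≤j j≤i adjacent with cycle-mod⇒consecutive adjacent
  ... | inj₁ e = %-distinct i≤j (<-trans (n<1+n j) (≤-trans j≤i (n≤1+n (i + N)))) e
  ... | inj₂ e = %-distinct (<-trans (n<1+n i) (≤-trans i≤j (n≤1+n j))) j≤i (sym e)

-- In `separate` the gaps from `i` up to `j` and from `j` up to `i + N` are both at least two: the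
-- indices are cyclically nonconsecutive.
record Antihole {n : ℕ} (G : Graph n) (N : ℕ) (v : ℕ → Fin n) : Set where
  field
    periodic    : ∀ i → v (N + i) ≡ v i
    consecutive : ∀ i → Far G (v i) (v (1 + i))
    separate    : ∀ {i j} → 2 + i ≤ j → 2 + j ≤ i + N → Near G (v i) (v j)

antihole : ∀ {n} (G : Graph n) N .{{_ : NonZero N}} → 2 ≤ N →
  ((f , _) : InducedSubgraph (complement (cycle N)) (square G)) → Antihole G N (λ i → f (i mod N))
antihole G N 2≤N (f , injective , iso) = record
  { periodic    = λ i → cong f (mod-periodic N i)
  ; consecutive = λ i near → proj₂ (Equivalence.from (iso _ _) (near⇒square G (distinct i) near))
      (cycle-mod-suc N 2≤N i)
  ; separate    = λ {i} {j} i≤j j≤i → square⇒near G (Equivalence.to (iso _ _)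
      ( (λ e → %-distinct N (<-trans (n<1+n i) i≤j) (<-trans (n<1+n j) j≤i)
           (trans (sym (toℕ-mod N i)) (trans (cong toℕ e) (toℕ-mod N j))))
      , mod-nonadjacent N i≤j j≤i))
  }
  where
  distinct : ∀ i → f (i mod N) ≢ f ((1 + i) mod N)
  distinct i e = adj-irrefl (cycle N) _
    (subst (Adj (cycle N) _) (sym (injective e)) (cycle-mod-suc N 2≤N i))

-- Excluding odd antiholes

module NoOddAntihole {n : ℕ} (G : Graph n)
  (P₆-free : path 6 -Free G) (bull-free : bull -Free G)
  (δ : Fin n → Fin n) (dominated : ∀ v → Dominates G (δ v) v)
  (unique : ∀ {u v} → Dominates G (δ u) v → δ v ≡ δ u)
  {N : ℕ} {v : ℕ → Fin n} (A : Antihole G N v) where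

  open Antihole A renaming (periodic to v-periodic)
  open Refuting G P₆-free bull-free δ dominated unique

  c : ℕ → Fin n
  c = δ ∘ v

  open CyclicColouring _≟_ N c (λ i → cong δ (v-periodic i)) (λ i → far⇒distinct (consecutive i))

  near : ∀ i k e → 2 + k ≤ e → 2 + e ≤ k + N → Near G (v (k + i)) (v (e + i))
  near i k e k≤e e≤k = separate (+-monoˡ-≤ i k≤e)
    (≤-trans (+-monoˡ-≤ i e≤k) (≤-reflexive (xy∙z≈xz∙y +-commutativeSemigroup k N i)))

  -- The core gives p the colour of x, and with p and q exchanged also q.
  rainbow-edge : ∀ i e → Rainbow i → 4 ≤ e → 3 + e ≤ N →
    c (e + i) ≡ c (1 + i) ⊎ c (1 + e + i) ≡ c (1 + i)
  rainbow-edge i e r 4≤e e≤N with c (e + i) ≟ c (1 + i) | c (1 + e + i) ≟ c (1 + i)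
  ... | yes p≡y | _       = inj₁ p≡y
  ... | no _    | yes q≡y = inj₂ q≡y
  ... | no p≢y  | no q≢y  = contradiction
      (trans (core x-y y-z p-q x~z (p~ 1) (q~ 1) (near-sym G (p~ 0)) (near-sym G (q~ 2)) r p≢y q≢y)
        (sym (core x-y y-z (far-sym G p-q) x~z (q~ 1) (p~ 1) (near-sym G (q~ 0)) (near-sym G (p~ 2)) r q≢y p≢y)))
      (far⇒distinct p-q)
    where
    x-y = consecutive i
    y-z = consecutive (1 + i)
    p-q = consecutive (e + i)
    x~z = near i 0 2 ≤-refl (≤-trans 4≤e (≤-trans (m≤n+m e 3) e≤N))
    p~ : ∀ k {k≤2 : True (k ≤? 2)} → Near G (v (k + i)) (v (e + i))
    p~ k {k≤2} = near i k e (≤-trans (+-monoʳ-≤ 2 (toWitness k≤2)) 4≤e)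
      (m≤n⇒m≤o+n k (≤-trans (n≤1+n (2 + e)) e≤N))
    q~ : ∀ k {k≤2 : True (k ≤? 2)} → Near G (v (k + i)) (v (1 + e + i))
    q~ k {k≤2} = near i k (1 + e) (m≤n⇒m≤1+n (≤-trans (+-monoʳ-≤ 2 (toWitness k≤2)) 4≤e))
      (m≤n⇒m≤o+n k e≤N)

  -- Three consecutive rainbows at `i`, `1 + i`, `2 + i` fit the core with `x`, `y`, `z`, `p`, `q`
  -- at `1 + i` to `5 + i`, where `5 + i` is the vertex of `i`. The middle rainbow separates `x`
  -- from `z`, the outer ones separate `q` and `p` from `y`.
  N≢5 : N ≢ 5
  N≢5 refl = pentagon-rainbows refl λ i r₀ r₁ r₂ →
    let x-y = consecutive (1 + i)
        y-z = consecutive (2 + i)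
        z-p = consecutive (3 + i)
        p-q = consecutive (4 + i)
        q-x = subst (λ w → Far G w (v (1 + i))) (sym (v-periodic i)) (consecutive i)
        x~z = near i 1 3 ≤-refl (n≤1+n 5)
        y~p = near i 2 4 ≤-refl (n≤1+n 6)
        y~q = near i 2 5 (n≤1+n 4) ≤-refl
        p~x = near-sym G (near i 1 4 (n≤1+n 3) ≤-refl)
        q~z = near-sym G (near i 3 5 ≤-refl (n≤1+n 7))
        p≢y = r₂ ∘ sym
        q≢y = r₀ ∘ trans (sym (cong δ (v-periodic i)))
        q≡z = core (far-sym G y-z) (far-sym G x-y) (far-sym G p-q) (near-sym G x~z)
                y~q y~p q~z p~x (r₁ ∘ sym) q≢y p≢y
    in core-twisted x-y y-z p-q x~z y~p y~q p~x q~z r₁ p≢y q≢y q≡z (far-sym G q-x) z-p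

  N-not-odd : ∀ k → 2 ≤ k → N ≢ 1 + k * 2
  N-not-odd 2 _ odd = N≢5 odd
  N-not-odd 3 _ odd = odd⇒rainbow {3} odd (no-rainbow₇ rainbow-edge odd)
  N-not-odd (suc (suc (suc (suc m)))) _ odd = odd⇒rainbow {4 + m} odd (no-rainbow₉ rainbow-edge {m} odd)
  N-not-odd 1 (s≤s ()) _

theorem5 : (n : ℕ) (G : Graph n) → path 6 -Free G → bull -Free G → ∃ (λ D → EfficientDominating G D) → OddAntiholeFree (square G)
theorem5 n G P₆-free bull-free (D , efficient) k 2≤k induced =
  N-not-odd (antihole G (1 + k * 2) (≤-trans 2≤k (m≤n⇒m≤1+n (m≤m*n k 2)))
    (subst (λ N → InducedSubgraph (complement (cycle N)) (square G)) 2k+1≡1+k2 induced)) k 2≤k refl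
  where
  δ : Fin n → Fin n
  δ v = proj₁ (efficient v)
  dominated : ∀ v → Dominates G (δ v) v
  dominated v = proj₂ (proj₁ (proj₂ (efficient v)))
  unique : ∀ {u v} → Dominates G (δ u) v → δ v ≡ δ u
  unique {u} {v} uv = proj₂ (proj₂ (efficient v)) (proj₁ (proj₁ (proj₂ (efficient u))) , uv)
  2k+1≡1+k2 : 2 * k + 1 ≡ 1 + k * 2
  2k+1≡1+k2 = trans (+-comm (2 * k) 1) (cong suc (*-comm 2 k))
  open NoOddAntihole G P₆-free bull-free δ dominated unique
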